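{- For all integers $n\geq k\geq 1$, $$H_1(n,k)=4^{k-1}(n-k)+\frac13\left(4^{k-1}-1\right).$$
   Context: For positive integers $r,n,k$, let $H_r(n,k)$ be the number of $n\times k$ arrays of integers (rows indexed $i=1,\dots,n$, columns indexed $j=1,\dots,k$) which obey the following rules: (1) the entry in position $(1,1)$ is $0$, and the entry in position $(n,k)$ is $\max(n,k)-r-1$; (2) the entry in position $(i,j)$ must equal or be one more than each of the entries in positions $(i-1,j)$, $(i,j-1)$, and $(i-1,j-1)$ (whenever those positions exist in the array); (3) the entry in position $(i,j)$ must be within $r$ of $\max(i,j)-1$, i.e. differ from it by at most $r$ in absolute value. (If the rules are contradictory, as for $n=k=1$, the count is $0$.) -}

module Defs where

open import Data.Nat.Base as ℕ using (ℕ; zero; suc; _⊔_)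
import Data.Nat.Properties as ℕ
open import Data.Integer.Base as ℤ using (ℤ; +_; -[1+_]; 0ℤ; 1ℤ; ∣_∣; _+_; _-_)
import Data.Integer.Properties as ℤ
open import Data.Integer.Tactic.RingSolver using (solve-∀)
open import Data.Rational.Base as ℚ using (ℚ)
open import Data.Fin.Base using (Fin; zero; suc; toℕ)
import Data.Fin.Properties as Fin
open import Data.Vec.Base using (Vec; []; _∷_; lookup)
import Data.Vec.Properties as Vec
open import Data.List.Base using (List; []; _∷_; [_]; _++_; map; upTo; length; filter; cartesianProductWith)
open import Data.List.Membership.Propositional using (_∈_)
import Data.List.Membership.Propositional.Properties as Mem
open import Data.List.Relation.Unary.Any using (here)
open import Data.List.Relation.Unary.All using ([])
open import Data.List.Relation.Unary.AllPairs using ([]; _∷_)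
open import Data.List.Relation.Unary.Unique.Propositional using (Unique)
import Data.List.Relation.Unary.Unique.Propositional.Properties as Unique
open import Data.Empty using (⊥)
open import Data.Product using (∃; _×_; _,_; proj₂)
open import Data.Sum using (_⊎_)
open import Function.Base using (_∘_)
open import Function.Bundles using (_⇔_; mk⇔)
open import Relation.Binary.PropositionalEquality using (_≡_; refl; cong)
open import Relation.Nullary.Decidable using (Dec; map′; _×-dec_; _⊎-dec_; _→-dec_)
open import Relation.Unary using (Decidable)

private variable
  n k : ℕ

Array : ℕ → ℕ → Set
Array n k = Vec (Vec ℤ k) n

entry : Array n k → Fin n → Fin k → ℤ
entry a i j = lookup (lookup a i) j

-- `Fin` counts from 0, whereas rows and columns are numbered from 1.
pos : Fin n → ℕ
pos i = suc (toℕ i)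

EqualsOrOneMoreThan : ℤ → ℤ → Set
EqualsOrOneMoreThan x y = x ≡ y ⊎ x ≡ y + 1ℤ

record IsValid (r n k : ℕ) (a : Array n k) : Set where
  field
    first      : ∀ i j → pos i ≡ 1 → pos j ≡ 1 → entry a i j ≡ 0ℤ
    last       : ∀ i j → pos i ≡ n → pos j ≡ k →
                 entry a i j ≡ + (n ⊔ k) - + r - 1ℤ
    vertical   : ∀ i i′ j → pos i ≡ suc (pos i′) →
                 EqualsOrOneMoreThan (entry a i j) (entry a i′ j)
    horizontal : ∀ i j j′ → pos j ≡ suc (pos j′) →
                 EqualsOrOneMoreThan (entry a i j) (entry a i j′)
    diagonal   : ∀ i i′ j j′ → pos i ≡ suc (pos i′) → pos j ≡ suc (pos j′) →
                 EqualsOrOneMoreThan (entry a i j) (entry a i′ j′)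
    bounded    : ∀ i j → ∣ entry a i j - (+ (pos i ⊔ pos j) - 1ℤ) ∣ ℕ.≤ r

equalsOrOneMoreThan? : ∀ x y → Dec (EqualsOrOneMoreThan x y)
equalsOrOneMoreThan? x y = (x ℤ.≟ y) ⊎-dec (x ℤ.≟ y + 1ℤ)

isValid? : ∀ r n k → Decidable (IsValid r n k)
isValid? r n k a = map′
  (λ (f , l , v , h , d , b) → record
    { first = f ; last = l ; vertical = v ; horizontal = h ; diagonal = d ; bounded = b })
  (λ p → let open IsValid p in first , last , vertical , horizontal , diagonal , bounded)
  ( (Fin.all? λ i → Fin.all? λ j →
       (pos i ℕ.≟ 1) →-dec (pos j ℕ.≟ 1) →-dec (entry a i j ℤ.≟ 0ℤ))
  ×-dec (Fin.all? λ i → Fin.all? λ j →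
       (pos i ℕ.≟ n) →-dec (pos j ℕ.≟ k) →-dec (entry a i j ℤ.≟ + (n ⊔ k) - + r - 1ℤ))
  ×-dec (Fin.all? λ i → Fin.all? λ i′ → Fin.all? λ j →
       (pos i ℕ.≟ suc (pos i′)) →-dec equalsOrOneMoreThan? (entry a i j) (entry a i′ j))
  ×-dec (Fin.all? λ i → Fin.all? λ j → Fin.all? λ j′ →
       (pos j ℕ.≟ suc (pos j′)) →-dec equalsOrOneMoreThan? (entry a i j) (entry a i j′))
  ×-dec (Fin.all? λ i → Fin.all? λ i′ → Fin.all? λ j → Fin.all? λ j′ →
       (pos i ℕ.≟ suc (pos i′)) →-dec (pos j ℕ.≟ suc (pos j′)) →-dec
       equalsOrOneMoreThan? (entry a i j) (entry a i′ j′))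
  ×-dec (Fin.all? λ i → Fin.all? λ j →
       ∣ entry a i j - (+ (pos i ⊔ pos j) - 1ℤ) ∣ ℕ.≤? r)
  )

-- The integers of absolute value at most b.
interval : ℕ → List ℤ
interval b = map +_ (upTo (suc b)) ++ map -[1+_] (upTo b)

vectors : ∀ {A : Set} → List A → ∀ n → List (Vec A n)
vectors xs zero    = [ [] ]
vectors xs (suc n) = cartesianProductWith _∷_ xs (vectors xs n)

-- `bounded` forces every entry of a valid array into `interval (n ⊔ k ℕ.+ r)`,
-- so the filter below misses none of them: see `∈-validArrays` and
-- `validArrays-unique`.
validArrays : ∀ r n k → List (Array n k)
validArrays r n k =
  filter (isValid? r n k) (vectors (vectors (interval (n ⊔ k ℕ.+ r)) k) n)

-- Only meant for positive n and k.
H : ℕ → ℕ → ℕ → ℕ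
H r n k = length (validArrays r n k)

∈-interval : ∀ b x → ∣ x ∣ ℕ.≤ b → x ∈ interval b
∈-interval b (+ t)    t≤b = Mem.∈-++⁺ˡ (Mem.∈-map⁺ +_ (Mem.∈-upTo⁺ (ℕ.s≤s t≤b)))
∈-interval b -[1+ t ] t<b =
  Mem.∈-++⁺ʳ (map +_ (upTo (suc b))) (Mem.∈-map⁺ -[1+_] (Mem.∈-upTo⁺ t<b))

interval-unique : ∀ b → Unique (interval b)
interval-unique b = Unique.++⁺
  (Unique.map⁺ ℤ.+-injective (Unique.upTo⁺ (suc b)))
  (Unique.map⁺ ℤ.-[1+-injective (Unique.upTo⁺ b))
  λ { (p , q) → disjoint (Mem.∈-map⁻ +_ p) (Mem.∈-map⁻ -[1+_] q) }
  where
  disjoint : ∀ {x} → ∃ (λ s → s ∈ upTo (suc b) × x ≡ + s) →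
             ∃ (λ t → t ∈ upTo b × x ≡ -[1+ t ]) → ⊥
  disjoint (_ , _ , refl) (_ , _ , ())

module _ {A : Set} {xs : List A} where

  ∈-vectors : ∀ {n} (v : Vec A n) → (∀ i → lookup v i ∈ xs) → v ∈ vectors xs n
  ∈-vectors []      h = here refl
  ∈-vectors (x ∷ v) h =
    Mem.∈-cartesianProductWith⁺ _∷_ (h zero) (∈-vectors v (h ∘ suc))

  vectors-unique : Unique xs → ∀ n → Unique (vectors xs n)
  vectors-unique u zero    = [] ∷ []
  vectors-unique u (suc n) =
    Unique.cartesianProductWith⁺ _∷_ Vec.∷-injective u (vectors-unique u n)

entry-bound : ∀ {r} {a : Array n k} → IsValid r n k a →
              ∀ i j → ∣ entry a i j ∣ ℕ.≤ n ⊔ k ℕ.+ r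
entry-bound {n} {k} {r} {a} valid i j = begin
  ∣ x ∣                 ≡⟨ cong ∣_∣ x≡m+[x-m] ⟩
  ∣ m + (x - m) ∣       ≤⟨ ℤ.∣i+j∣≤∣i∣+∣j∣ m (x - m) ⟩
  ∣ m ∣ ℕ.+ ∣ x - m ∣   ≤⟨ ℕ.+-mono-≤ m≤ (IsValid.bounded valid i j) ⟩
  n ⊔ k ℕ.+ r           ∎
  where
  open ℕ.≤-Reasoning
  x m : ℤ
  x = entry a i j
  m = + (pos i ⊔ pos j) - 1ℤ
  regroup : ∀ y z → y ≡ z + (y - z)
  regroup = solve-∀
  x≡m+[x-m] : x ≡ m + (x - m)
  x≡m+[x-m] = regroup x m
  m≤ : ∣ m ∣ ℕ.≤ n ⊔ k
  m≤ = ℕ.⊔-mono-≤ (ℕ.<⇒≤ (Fin.toℕ<n i)) (ℕ.<⇒≤ (Fin.toℕ<n j))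

∈-validArrays : ∀ r n k a → a ∈ validArrays r n k ⇔ IsValid r n k a
∈-validArrays r n k a = mk⇔
  (λ a∈ → proj₂ (Mem.∈-filter⁻ (isValid? r n k) {xs = candidates} a∈))
  (λ valid → Mem.∈-filter⁺ (isValid? r n k)
    (∈-vectors a λ i → ∈-vectors (lookup a i) λ j →
      ∈-interval (n ⊔ k ℕ.+ r) (entry a i j) (entry-bound valid i j))
    valid)
  where
  candidates : List (Array n k)
  candidates = vectors (vectors (interval (n ⊔ k ℕ.+ r)) k) n

validArrays-unique : ∀ r n k → Unique (validArrays r n k)
validArrays-unique r n k = Unique.filter⁺ (isValid? r n k)
  (vectors-unique (vectors-unique (interval-unique (n ⊔ k ℕ.+ r)) k) n)

fromℕ : ℕ → ℚ
fromℕ m = + m ℚ./ 1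

{-# OPTIONS --safe #-}

-- Write b(i,j) = max(i,j) - 1 - a(i,j). The rules for r = 1 say that b is a 0/1 array which is
-- nondecreasing along diagonals and, on and below the main diagonal, nondecreasing down columns
-- and nonincreasing along rows (the other way round above it), with b(1,1) = 0 and b(n,k) = 1.
-- Delete the first row and the first column. If the rest starts with 0, it is an array of the
-- same kind for (n-1,k-1), and monotonicity leaves two positions for the last 0 of the deleted
-- column (as far from the main diagonal as in the next column, or one further) and,
-- independently, two for that of the deleted row. If the rest starts with 1, everything is
-- forced. Hence H(n,k) = 4 H(n-1,k-1) + 1, with H(n,1) = n - 1.
module Submission where

open import Defs
open import Data.Nat.Base as ℕ
  using (ℕ; zero; suc; _≤_; _≥_; _<_; _<ᵇ_; _⊔_; _∸_; _^_; z≤n; s≤s)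
import Data.Nat.Properties as ℕ
open import Data.Nat.DivMod using (_mod_; m<n⇒m%n≡m)
open import Data.Nat.Tactic.RingSolver using () renaming (solve-∀ to solveℕ-∀)
open import Data.Integer.Base as ℤ using (ℤ; +_; -[1+_]; 0ℤ; 1ℤ; ∣_∣)
import Data.Integer.Properties as ℤ
open import Data.Integer.Tactic.RingSolver using () renaming (solve-∀ to solveℤ-∀)
open import Algebra.Properties.AbelianGroup ℤ.+-0-abelianGroup using (∙-cancelˡ)
open import Data.Rational.Base using (ℚ; 1ℚ; _+_; _-_; _*_; _/_; toℚᵘ)
import Data.Rational.Properties as ℚ
open import Data.Rational.Solver using (module +-*-Solver)
open import Data.Rational.Unnormalised.Base as ℚᵘ using (mkℚᵘ; *≡*)
import Data.Rational.Unnormalised.Properties as ℚᵘ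
open import Data.Bool.Base using (Bool; true; false; T)
open import Data.Fin.Base using (Fin; toℕ; fromℕ<)
import Data.Fin.Properties as Fin
open import Data.Vec.Base using (lookup; tabulate)
import Data.Vec.Properties as Vec
open import Data.List.Base
  using (List; []; _∷_; map; length; allFin; cartesianProduct; cartesianProductWith)
import Data.List.Properties as List
open import Data.List.Membership.Propositional using (_∈_)
import Data.List.Membership.Propositional.Properties as Mem
open import Data.List.Membership.Propositional.Properties.WithK using (unique∧set⇒bag)
open import Data.List.Relation.Binary.BagAndSetEquality using (∼bag⇒↭)
open import Data.List.Relation.Binary.Permutation.Propositional.Properties using (↭-length)
open import Data.List.Relation.Unary.Any using (here; there)
open import Data.List.Relation.Unary.All as All using ([]; _∷_)
open import Data.List.Relation.Unary.AllPairs using ([]; _∷_)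
open import Data.List.Relation.Unary.Unique.Propositional using (Unique)
import Data.List.Relation.Unary.Unique.Propositional.Properties as Unique
open import Data.Product using (∃-syntax; _×_; _,_; proj₁; proj₂; uncurry)
open import Data.Sum using (inj₁; inj₂)
open import Data.Unit using (tt)
open import Data.Empty using (⊥-elim)
open import Function.Base using (id; _∘_)
open import Function.Bundles using (mk⇔; module Equivalence)
open import Relation.Binary.PropositionalEquality
  using (_≡_; _≢_; refl; sym; trans; cong; cong₂; subst; subst₂; module ≡-Reasoning)
open import Relation.Nullary using (¬_; yes; no; isYes; contradiction)

-- Boolean implications and shifts by at most one.

infix 4 _⟹_

_⟹_ : Bool → Bool → Set
x ⟹ y = T x → T y

⟹-antisym : ∀ {x y} → x ⟹ y → y ⟹ x → x ≡ y
⟹-antisym {false} {false} _ _ = refl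
⟹-antisym {false} {true}  _ g = ⊥-elim (g tt)
⟹-antisym {true}  {false} f _ = ⊥-elim (f tt)
⟹-antisym {true}  {true}  _ _ = refl

≡⇒⟹ : ∀ {x y} → x ≡ y → x ⟹ y
≡⇒⟹ = subst T

<ᵇ-weaken : ∀ s t i j → (s < i → t < j) → (s <ᵇ i) ⟹ (t <ᵇ j)
<ᵇ-weaken s t i j h = ℕ.<⇒<ᵇ ∘ h ∘ ℕ.<ᵇ⇒< s i

-- Here `t` is the last 0 of the neighbouring column or row, and the flag selects one of the two
-- positions compatible with it.
bump : Bool → ℕ → ℕ
bump false t = t
bump true  t = suc t

bump≤suc : ∀ p t → bump p t ≤ suc t
bump≤suc false t = ℕ.n≤1+n t
bump≤suc true  t = ℕ.≤-refl

≤bump : ∀ p t → t ≤ bump p t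
≤bump false t = ℕ.≤-refl
≤bump true  t = ℕ.n≤1+n t

bump-injective : ∀ p q t → bump p t ≡ bump q t → p ≡ q
bump-injective false false t eq = refl
bump-injective false true  t eq = contradiction (sym eq) ℕ.1+n≢n
bump-injective true  false t eq = contradiction eq ℕ.1+n≢n
bump-injective true  true  t eq = refl

between⇒bump : ∀ {s t} → t ≤ s → s ≤ suc t → ∃[ p ] s ≡ bump p t
between⇒bump {s} {t} t≤s s≤1+t with ℕ.m≤n⇒m<n∨m≡n t≤s
... | inj₁ t<s = true , ℕ.≤-antisym s≤1+t t<s
... | inj₂ t≡s = false , sym t≡s

-- Codes for the 0/1 arrays.

-- A code of type Code m k describes an array b with 1 + k + m rows and 1 + k columns: `step` adds a
-- row and a column, `ones` stands for the array whose only 0 is its first entry.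
data Code (m : ℕ) : ℕ → Set where
  base : Fin m → Code m 0
  ones : ∀ {k} → Code m (suc k)
  step : ∀ {k} → Bool → Bool → Code m k → Code m (suc k)

private variable
  m k : ℕ

-- The index of the last 0 in the first column and in the first row.
height width : Code m k → ℕ
height (base i)     = toℕ i
height ones         = 0
height (step p q c) = bump p (height c)
width (base i)     = 0
width ones         = 0
width (step p q c) = bump q (width c)

-- Only the indices i ≤ k + m, j ≤ k matter. Beyond its single column, `base` is continued
-- constantly along diagonals, so that the inequalities between neighbours hold everywhere.
bit : Code m k → ℕ → ℕ → Bool
bit c            i       zero    = height c <ᵇ i
bit c            zero    (suc j) = width c <ᵇ suc j
bit (base s)     (suc i) (suc j) = bit (base s) i j
bit ones         (suc i) (suc j) = true
bit (step p q c) (suc i) (suc j) = bit c i j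

bit-row : ∀ (c : Code m k) j → bit c 0 j ≡ (width c <ᵇ j)
bit-row c zero    = refl
bit-row c (suc j) = refl

height-≤ : ∀ (c : Code m k) → height c ≤ k ℕ.+ m
height-≤ (base i) = ℕ.<⇒≤ (Fin.toℕ<n i)
height-≤ ones = z≤n
height-≤ (step p q c) = ℕ.≤-trans (bump≤suc p _) (s≤s (height-≤ c))

width-≤ : ∀ (c : Code m k) → width c ≤ k
width-≤ (base i) = z≤n
width-≤ ones = z≤n
width-≤ (step p q c) = ℕ.≤-trans (bump≤suc q _) (s≤s (width-≤ c))

-- Codes give staircases.

-- The indices i ≤ N and j ≤ K count from 0; f i j is true where b equals 1.
record IsStaircase (N K : ℕ) (f : ℕ → ℕ → Bool) : Set where
  field
    start       : ¬ T (f 0 0)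
    end         : T (f N K)
    down-lower  : ∀ i j → i < N → j ≤ K → j ≤ i → f i j ⟹ f (suc i) j
    down-upper  : ∀ i j → i < N → j ≤ K → i < j → f (suc i) j ⟹ f i j
    right-upper : ∀ i j → i ≤ N → j < K → i ≤ j → f i j ⟹ f i (suc j)
    right-lower : ∀ i j → i ≤ N → j < K → j < i → f i (suc j) ⟹ f i j
    diagonal    : ∀ i j → i < N → j < K → f i j ⟹ f (suc i) (suc j)

bit-end : ∀ (c : Code m k) → T (bit c (k ℕ.+ m) k)
bit-end (base i)     = ℕ.<⇒<ᵇ (Fin.toℕ<n i)
bit-end ones         = tt
bit-end (step p q c) = bit-end c

-- Lowering both indices together leads to the border or, for `ones`, to a constant 1. So here and
-- in the next four lemmas only border comparisons carry content.
bit-down-lower : ∀ (c : Code m k) i j → j ≤ i → bit c i j ⟹ bit c (suc i) j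
bit-down-lower c i zero _ = <ᵇ-weaken (height c) (height c) i (suc i) ℕ.m<n⇒m<1+n
bit-down-lower (base s)     (suc i) (suc j) (s≤s j≤i) = bit-down-lower (base s) i j j≤i
bit-down-lower ones         (suc i) (suc j) (s≤s j≤i) = id
bit-down-lower (step p q c) (suc i) (suc j) (s≤s j≤i) = bit-down-lower c i j j≤i

bit-right-upper : ∀ (c : Code m k) i j → i ≤ j → bit c i j ⟹ bit c i (suc j)
bit-right-upper c zero zero _ = λ ()
bit-right-upper c zero (suc j) _ = <ᵇ-weaken (width c) (width c) (suc j) (2 ℕ.+ j) ℕ.m<n⇒m<1+n
bit-right-upper (base s)     (suc i) (suc j) (s≤s i≤j) = bit-right-upper (base s) i j i≤j
bit-right-upper ones         (suc i) (suc j) (s≤s i≤j) = id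
bit-right-upper (step p q c) (suc i) (suc j) (s≤s i≤j) = bit-right-upper c i j i≤j

bit-right-lower : ∀ (c : Code m k) i j → j < i → bit c i (suc j) ⟹ bit c i j
bit-right-lower (base s) (suc i) zero _ = <ᵇ-weaken (toℕ s) (toℕ s) i (suc i) ℕ.m<n⇒m<1+n
bit-right-lower ones (suc i) zero _ = id
-- The border column has its last 0 at most one further from the diagonal than the next column.
bit-right-lower (step p q c) (suc i) zero _ = <ᵇ-weaken (height c) _ i (suc i)
  λ h<i → s≤s (ℕ.≤-trans (bump≤suc p _) h<i)
bit-right-lower (base s)     (suc i) (suc j) (s≤s j<i) = bit-right-lower (base s) i j j<i
bit-right-lower ones         (suc i) (suc j) (s≤s j<i) = id
bit-right-lower (step p q c) (suc i) (suc j) (s≤s j<i) = bit-right-lower c i j j<i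

bit-down-upper : ∀ (c : Code m k) i j → i < j → bit c (suc i) j ⟹ bit c i j
bit-down-upper (base s) zero (suc j) _ = λ _ → tt
bit-down-upper ones zero (suc j) _ = id
bit-down-upper (step p q c) zero (suc j) _ = <ᵇ-weaken (width c) _ j (suc j)
  (λ h<i → s≤s (ℕ.≤-trans (bump≤suc q _) h<i)) ∘ ≡⇒⟹ (bit-row c j)
bit-down-upper (base s)     (suc i) (suc j) (s≤s i<j) = bit-down-upper (base s) i j i<j
bit-down-upper ones         (suc i) (suc j) (s≤s i<j) = id
bit-down-upper (step p q c) (suc i) (suc j) (s≤s i<j) = bit-down-upper c i j i<j

bit-diagonal : ∀ (c : Code m k) i j → bit c i j ⟹ bit c (suc i) (suc j)
bit-diagonal (base s) i zero = id
bit-diagonal (base s) zero (suc j) = id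
bit-diagonal ones i zero = λ _ → tt
bit-diagonal ones zero (suc j) = id
-- Conversely, it is at least as far from the diagonal.
bit-diagonal (step p q c) i zero = <ᵇ-weaken _ (height c) i i (ℕ.≤-<-trans (≤bump p _))
bit-diagonal (step p q c) zero (suc j) =
  <ᵇ-weaken _ (width c) (suc j) (suc j) (ℕ.≤-<-trans (≤bump q _))
bit-diagonal (base s)     (suc i) (suc j) = bit-diagonal (base s) i j
bit-diagonal ones         (suc i) (suc j) = id
bit-diagonal (step p q c) (suc i) (suc j) = bit-diagonal c i j

bit-isStaircase : ∀ (c : Code m k) → IsStaircase (k ℕ.+ m) k (bit c)
bit-isStaircase c = record
  { start       = λ ()
  ; end         = bit-end c
  ; down-lower  = λ i j _ _ → bit-down-lower c i j
  ; down-upper  = λ i j _ _ → bit-down-upper c i j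
  ; right-upper = λ i j _ _ → bit-right-upper c i j
  ; right-lower = λ i j _ _ → bit-right-lower c i j
  ; diagonal    = λ i j _ _ → bit-diagonal c i j
  }

-- Thresholds of monotone 0/1 sequences.

-- The implication is tested at `suc t`, the first index where `t <ᵇ i` holds. If that exceeds `N`,
-- then `N ≤ t` and the a priori bound on `s` suffices.
threshold-≤ : ∀ r {s t N} → s ≤ r ℕ.+ N →
              (∀ i → i ≤ N → (t <ᵇ i) ⟹ (s <ᵇ r ℕ.+ i)) → s ≤ r ℕ.+ t
threshold-≤ r {s} {t} {N} s≤ h with t ℕ.<? N
... | yes t<N = ℕ.s≤s⁻¹ (subst (s <_) (ℕ.+-suc r t)
                  (ℕ.<ᵇ⇒< s _ (h (suc t) t<N (ℕ.<⇒<ᵇ (ℕ.n<1+n t)))))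
... | no t≮N = ℕ.≤-trans s≤ (ℕ.+-monoʳ-≤ r (ℕ.≮⇒≥ t≮N))

-- The bounds by `N` matter: all thresholds from `N` on give the same all-false sequence on the
-- indices up to `N`.
threshold-unique : ∀ {s t N} → s ≤ N → t ≤ N →
                   (∀ i → i ≤ N → (s <ᵇ i) ≡ (t <ᵇ i)) → s ≡ t
threshold-unique s≤N t≤N h = ℕ.≤-antisym
  (threshold-≤ 0 s≤N λ i i≤N → ≡⇒⟹ (sym (h i i≤N)))
  (threshold-≤ 0 t≤N λ i i≤N → ≡⇒⟹ (h i i≤N))

threshold : ∀ (g : ℕ → Bool) N → ¬ T (g 0) → (∀ i → i < N → g i ⟹ g (suc i)) →
            ∃[ t ] t ≤ N × (∀ i → i ≤ N → g i ≡ (t <ᵇ i))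
threshold g zero g0 mono = 0 , z≤n , λ { zero z≤n → ⟹-antisym g0 (λ ()) }
threshold g (suc N) g0 mono
  with t , t≤N , eq ← threshold g N g0 (λ i i<N → mono i (ℕ.m<n⇒m<1+n i<N))
  with g (suc N) in gN
-- A 0 at `suc N` forces 0 everywhere before it, so the threshold jumps to `suc N`; a 1 there keeps
-- the threshold of the shorter sequence.
... | false = suc N , ℕ.≤-refl , λ i i≤ → ⟹-antisym (λ gi → below i i≤ gi)
        (λ lt → contradiction (ℕ.<ᵇ⇒< (suc N) i lt) (ℕ.≤⇒≯ i≤))
  where
  below : ∀ i → i ≤ suc N → g i ⟹ (suc N <ᵇ i)
  below i i≤ gi with ℕ.m≤n⇒m<n∨m≡n i≤
  ... | inj₂ refl = ⊥-elim (subst T gN gi)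
  ... | inj₁ (s≤s i≤N) = ⊥-elim (subst T gN (mono N ℕ.≤-refl (subst T (sym (eq N ℕ.≤-refl))
          (<ᵇ-weaken t t i N (λ t<i → ℕ.≤-trans t<i i≤N) (subst T (eq i i≤N) gi)))))
... | true = t , ℕ.m≤n⇒m≤1+n t≤N , at
  where
  at : ∀ i → i ≤ suc N → g i ≡ (t <ᵇ i)
  at i i≤ with ℕ.m≤n⇒m<n∨m≡n i≤
  ... | inj₂ refl = trans gN (⟹-antisym (λ _ → ℕ.<⇒<ᵇ (s≤s t≤N)) (λ _ → tt))
  ... | inj₁ (s≤s i≤N) = eq i i≤N

-- Injectivity of the coding.

-- Entry (1,1) is 1 for `ones` and 0 for `step`, so it fixes the constructor. The tail then fixes
-- `c`, and the thresholds of the first column and row fix the two flags.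
bit-injective : ∀ (c d : Code m k) →
  (∀ i j → i ≤ k ℕ.+ m → j ≤ k → bit c i j ≡ bit d i j) → c ≡ d
bit-injective {m} (base s) (base t) h = cong base (Fin.toℕ-injective
  (threshold-unique (height-≤ (base s)) (height-≤ (base t)) λ i i≤m → h i 0 i≤m z≤n))
bit-injective ones ones h = refl
bit-injective ones (step p q d) h with () ← h 1 1 (s≤s z≤n) (s≤s z≤n)
bit-injective (step p q c) ones h with () ← h 1 1 (s≤s z≤n) (s≤s z≤n)
bit-injective c₀@(step p q c) d₀@(step p′ q′ d) h
  with refl ← bit-injective c d (λ i j i≤ j≤ → h (suc i) (suc j) (s≤s i≤) (s≤s j≤))
  = cong₂ (λ p q → step p q c)
    (bump-injective p p′ (height c) (threshold-unique (height-≤ c₀) (height-≤ d₀)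
      λ i i≤ → h i 0 i≤ z≤n))
    (bump-injective q q′ (width c) (threshold-unique (width-≤ c₀) (width-≤ d₀)
      λ j j≤ → trans (sym (bit-row c₀ j)) (trans (h 0 j z≤n j≤) (bit-row d₀ j))))

-- Every staircase has a code.

-- s and t are the positions of the last 0 in two neighbouring columns (or rows), both counted from
-- the main diagonal.
interlace : ∀ {g g′ : ℕ → Bool} {N s t} → s ≤ suc N → t ≤ N →
  (∀ i → i ≤ suc N → g i ≡ (s <ᵇ i)) → (∀ i → i ≤ N → g′ i ≡ (t <ᵇ i)) →
  (∀ i → i ≤ N → g′ i ⟹ g (suc i)) → (∀ i → i ≤ N → g i ⟹ g′ i) →
  ∃[ p ] s ≡ bump p t
interlace s≤ t≤ gs g′t up down = between⇒bump
  (threshold-≤ 0 t≤ λ i i≤ → ≡⇒⟹ (g′t i i≤) ∘ down i i≤ ∘ ≡⇒⟹ (sym (gs i (ℕ.m≤n⇒m≤1+n i≤))))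
  (threshold-≤ 1 s≤ λ i i≤ → ≡⇒⟹ (gs (suc i) (s≤s i≤)) ∘ up i i≤ ∘ ≡⇒⟹ (sym (g′t i i≤)))

module _ {N K f} (st : IsStaircase (suc N) (suc K) f) where
  open IsStaircase st

  -- The shift by (1,1) preserves the main diagonal, so all comparisons are inherited; only the new
  -- start needs a hypothesis.
  IsStaircase-tail : ¬ T (f 1 1) → IsStaircase N K (λ i j → f (suc i) (suc j))
  IsStaircase-tail f11 = record
    { start       = f11
    ; end         = end
    ; down-lower  = λ i j i< j≤ h → down-lower (suc i) (suc j) (s≤s i<) (s≤s j≤) (s≤s h)
    ; down-upper  = λ i j i< j≤ h → down-upper (suc i) (suc j) (s≤s i<) (s≤s j≤) (s≤s h)
    ; right-upper = λ i j i≤ j< h → right-upper (suc i) (suc j) (s≤s i≤) (s≤s j<) (s≤s h)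
    ; right-lower = λ i j i≤ j< h → right-lower (suc i) (suc j) (s≤s i≤) (s≤s j<) (s≤s h)
    ; diagonal    = λ i j i< j< → diagonal (suc i) (suc j) (s≤s i<) (s≤s j<)
    }

  -- The first column lies on or below the diagonal and the first row on or above it, so both are
  -- nondecreasing throughout.
  first-column : ∃[ t ] t ≤ suc N × (∀ i → i ≤ suc N → f i 0 ≡ (t <ᵇ i))
  first-column = threshold (λ i → f i 0) (suc N) start λ i i<N → down-lower i 0 i<N z≤n z≤n

  first-row : ∃[ t ] t ≤ suc K × (∀ j → j ≤ suc K → f 0 j ≡ (t <ᵇ j))
  first-row = threshold (f 0) (suc K) start λ j j<K → right-upper 0 j z≤n j<K z≤n

  -- The 1 at (1,1) spreads down column 1 and along row 1, and from there along diagonals.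
  tail-ones : T (f 1 1) → ∀ i j → i ≤ N → j ≤ K → T (f (suc i) (suc j))
  tail-ones f11 zero    zero    _  _  = f11
  tail-ones f11 (suc i) zero    i< j≤ =
    down-lower (suc i) 1 (s≤s i<) (s≤s z≤n) (s≤s z≤n) (tail-ones f11 i 0 (ℕ.<⇒≤ i<) z≤n)
  tail-ones f11 zero    (suc j) i≤ j< =
    right-upper 1 (suc j) (s≤s z≤n) (s≤s j<) (s≤s z≤n) (tail-ones f11 0 j z≤n (ℕ.<⇒≤ j<))
  tail-ones f11 (suc i) (suc j) i< j< =
    diagonal (suc i) (suc j) (s≤s i<) (s≤s j<) (tail-ones f11 i j (ℕ.<⇒≤ i<) (ℕ.<⇒≤ j<))

  -- Each border entry other than the corner is next to an entry of the all-ones tail, and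
  -- `right-lower` or `down-upper` carries the 1 back to it.
  border-ones : T (f 1 1) → (∀ i → i ≤ suc N → f i 0 ≡ (0 <ᵇ i)) ×
                            (∀ j → j ≤ suc K → f 0 j ≡ (0 <ᵇ j))
  border-ones f11 = column , row
    where
    column : ∀ i → i ≤ suc N → f i 0 ≡ (0 <ᵇ i)
    column zero    _  = ⟹-antisym start λ ()
    column (suc i) i≤ = ⟹-antisym (λ _ → tt) λ _ →
      right-lower (suc i) 0 i≤ (s≤s z≤n) (s≤s z≤n) (tail-ones f11 i 0 (ℕ.s≤s⁻¹ i≤) z≤n)
    row : ∀ j → j ≤ suc K → f 0 j ≡ (0 <ᵇ j)
    row zero    _  = ⟹-antisym start λ ()
    row (suc j) j≤ = ⟹-antisym (λ _ → tt) λ _ →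
      down-upper 0 (suc j) (s≤s z≤n) j≤ (s≤s z≤n) (tail-ones f11 0 j z≤n (ℕ.s≤s⁻¹ j≤))

assemble : ∀ {N K} {f : ℕ → ℕ → Bool} (c : Code m (suc k)) →
  (∀ i → i ≤ N → f i 0 ≡ (height c <ᵇ i)) → (∀ j → j ≤ K → f 0 j ≡ (width c <ᵇ j)) →
  (∀ i j → suc i ≤ N → suc j ≤ K → f (suc i) (suc j) ≡ bit c (suc i) (suc j)) →
  ∀ i j → i ≤ N → j ≤ K → f i j ≡ bit c i j
assemble c col row rest i       zero    i≤ _  = col i i≤
assemble c col row rest zero    (suc j) _  j≤ = row (suc j) j≤
assemble c col row rest (suc i) (suc j) i≤ j≤ = rest i j i≤ j≤

bit-surjective : ∀ k {f} → IsStaircase (k ℕ.+ m) k f →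
  ∃[ c ] (∀ i j → i ≤ k ℕ.+ m → j ≤ k → f i j ≡ bit {m} {k} c i j)
bit-surjective {m} zero {f} st
  with t , _ , eq ← threshold (λ i → f i 0) m (IsStaircase.start st)
                      (λ i i<m → IsStaircase.down-lower st i 0 i<m z≤n z≤n)
  = base (fromℕ< t<m) , λ { i zero i≤ z≤n →
      trans (eq i i≤) (cong (_<ᵇ i) (sym (Fin.toℕ-fromℕ< t<m))) }
  where
  -- The final entry 1 keeps the last 0 before index `m`, whence the `m` choices of `base`.
  t<m : t < m
  t<m = ℕ.<ᵇ⇒< t m (≡⇒⟹ (eq m ℕ.≤-refl) (IsStaircase.end st))
bit-surjective {m} (suc k) {f} st with f 1 1 in f11
... | true = ones , assemble ones (proj₁ border) (proj₂ border)
        λ i j i< j< → ⟹-antisym (λ _ → tt) λ _ →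
          tail-ones st (subst T (sym f11) tt) i j (ℕ.s≤s⁻¹ i<) (ℕ.s≤s⁻¹ j<)
  where
  border : _
  border = border-ones st (subst T (sym f11) tt)
... | false
  with c , eq ← bit-surjective {m} k (IsStaircase-tail st (subst T f11))
  with s , s≤ , col ← first-column st
  with t , t≤ , row ← first-row st
  -- `right-lower` puts the last 0 of the first column at most one further from the diagonal than
  -- that of the next, `diagonal` at least as far. For the first row `down-upper` replaces
  -- `right-lower`.
  with p , refl ← interlace s≤ (height-≤ c) col (λ i i≤ → eq i 0 i≤ z≤n)
         (λ i i≤ → IsStaircase.right-lower st (suc i) 0 (s≤s i≤) (s≤s z≤n) (s≤s z≤n))
         (λ i i≤ → IsStaircase.diagonal st i 0 (s≤s i≤) (s≤s z≤n))
  with q , refl ← interlace t≤ (width-≤ c) row (λ j j≤ → trans (eq 0 j z≤n j≤) (bit-row c j))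
         (λ j j≤ → IsStaircase.down-upper st 0 (suc j) (s≤s z≤n) (s≤s j≤) (s≤s z≤n))
         (λ j j≤ → IsStaircase.diagonal st 0 j (s≤s z≤n) (s≤s j≤))
  = step p q c , assemble (step p q c) col row λ i j i< j< → eq i j (ℕ.s≤s⁻¹ i<) (ℕ.s≤s⁻¹ j<)

-- Staircases give valid arrays.

weight : Bool → ℤ
weight false = 0ℤ
weight true  = 1ℤ

-- Indices count from 0, so `i ⊔ j` is already the maximum of the one-based positions minus 1.
value : (ℕ → ℕ → Bool) → ℕ → ℕ → ℤ
value f i j = + (i ⊔ j) ℤ.- weight (f i j)

toArray : ∀ {n k} → (ℕ → ℕ → Bool) → Array n k
toArray f = tabulate λ i → tabulate λ j → value f (toℕ i) (toℕ j)

entry-toArray : ∀ {n k} f i j → entry (toArray {n} {k} f) i j ≡ value f (toℕ i) (toℕ j)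
entry-toArray f i j = trans
  (cong (λ row → lookup row j) (Vec.lookup∘tabulate _ i))
  (Vec.lookup∘tabulate _ j)

toArray-unique : ∀ {n k} (a : Array n k) f →
  (∀ i j → entry a i j ≡ value f (toℕ i) (toℕ j)) → a ≡ toArray f
toArray-unique a f h = trans (sym (Vec.tabulate∘lookup a)) (Vec.tabulate-cong λ i →
  trans (sym (Vec.tabulate∘lookup (lookup a i))) (Vec.tabulate-cong (h i)))

+-cancel-EqualsOrOneMoreThan : ∀ z {x y} →
  EqualsOrOneMoreThan (z ℤ.+ x) (z ℤ.+ y) → EqualsOrOneMoreThan x y
+-cancel-EqualsOrOneMoreThan z {x} {y} (inj₁ eq) = inj₁ (∙-cancelˡ z x y eq)
+-cancel-EqualsOrOneMoreThan z {x} {y} (inj₂ eq) =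
  inj₂ (∙-cancelˡ z x (y ℤ.+ 1ℤ) (trans eq (ℤ.+-assoc z y 1ℤ)))

+-mono-EqualsOrOneMoreThan : ∀ z {x y} →
  EqualsOrOneMoreThan x y → EqualsOrOneMoreThan (z ℤ.+ x) (z ℤ.+ y)
+-mono-EqualsOrOneMoreThan z (inj₁ eq) = inj₁ (cong (ℤ._+_ z) eq)
+-mono-EqualsOrOneMoreThan z {y = y} (inj₂ eq) =
  inj₂ (trans (cong (ℤ._+_ z) eq) (sym (ℤ.+-assoc z y 1ℤ)))

-- The entries differ by `weight y` minus `weight x`, which is 0 or 1 unless `x` is true and `y`
-- false.
sameMax⁺ : ∀ {M M′} x y → M ≡ M′ → x ⟹ y →
  EqualsOrOneMoreThan (+ M ℤ.- weight x) (+ M′ ℤ.- weight y)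
sameMax⁺ {M} x y refl h = +-mono-EqualsOrOneMoreThan (+ M) (cases x y h)
  where
  cases : ∀ x y → x ⟹ y → EqualsOrOneMoreThan (ℤ.- weight x) (ℤ.- weight y)
  cases false false h = inj₁ refl
  cases false true  h = inj₂ refl
  cases true  false h = ⊥-elim (h tt)
  cases true  true  h = inj₁ refl

sameMax⁻ : ∀ {M M′} x y → M ≡ M′ →
  EqualsOrOneMoreThan (+ M ℤ.- weight x) (+ M′ ℤ.- weight y) → x ⟹ y
sameMax⁻ {M} x y refl h = cases x y (+-cancel-EqualsOrOneMoreThan (+ M) h)
  where
  cases : ∀ x y → EqualsOrOneMoreThan (ℤ.- weight x) (ℤ.- weight y) → x ⟹ y
  cases false y h ()
  cases true true h = id
  cases true false (inj₁ ())
  cases true false (inj₂ ())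

suc-minus : ∀ M w → + suc M ℤ.- w ≡ + M ℤ.+ (1ℤ ℤ.- w)
suc-minus M w = trans (cong (ℤ._- w) (ℤ.+-comm 1ℤ (+ M))) (ℤ.+-assoc (+ M) 1ℤ (ℤ.- w))

-- The larger maximum adds 1 to the difference, so the only excluded case is now `x` false and `y`
-- true: the implication is reversed.
sucMax⁺ : ∀ {M M′} x y → M ≡ suc M′ → y ⟹ x →
  EqualsOrOneMoreThan (+ M ℤ.- weight x) (+ M′ ℤ.- weight y)
sucMax⁺ {M′ = M} x y refl h =
  subst (λ z → EqualsOrOneMoreThan z (+ M ℤ.- weight y)) (sym (suc-minus M (weight x)))
    (+-mono-EqualsOrOneMoreThan (+ M) (cases x y h))
  where
  cases : ∀ x y → y ⟹ x → EqualsOrOneMoreThan (1ℤ ℤ.- weight x) (ℤ.- weight y)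
  cases false false h = inj₂ refl
  cases false true  h = ⊥-elim (h tt)
  cases true  false h = inj₁ refl
  cases true  true  h = inj₂ refl

sucMax⁻ : ∀ {M M′} x y → M ≡ suc M′ →
  EqualsOrOneMoreThan (+ M ℤ.- weight x) (+ M′ ℤ.- weight y) → y ⟹ x
sucMax⁻ {M′ = M} x y refl h = cases x y (+-cancel-EqualsOrOneMoreThan (+ M)
  (subst (λ z → EqualsOrOneMoreThan z (+ M ℤ.- weight y)) (suc-minus M (weight x)) h))
  where
  cases : ∀ x y → EqualsOrOneMoreThan (1ℤ ℤ.- weight x) (ℤ.- weight y) → y ⟹ x
  cases x     false h ()
  cases true  true  h = id
  cases false true  (inj₁ ())
  cases false true  (inj₂ ())

⊔-riseˡ : ∀ {i j} → j ≤ i → suc i ⊔ j ≡ suc (i ⊔ j)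
⊔-riseˡ j≤i = trans (ℕ.m≥n⇒m⊔n≡m (ℕ.m≤n⇒m≤1+n j≤i)) (cong suc (sym (ℕ.m≥n⇒m⊔n≡m j≤i)))

⊔-riseʳ : ∀ {i j} → i ≤ j → i ⊔ suc j ≡ suc (i ⊔ j)
⊔-riseʳ i≤j = trans (ℕ.m≤n⇒m⊔n≡n (ℕ.m≤n⇒m≤1+n i≤j)) (cong suc (sym (ℕ.m≤n⇒m⊔n≡n i≤j)))

⊔-flatˡ : ∀ {i j} → i < j → suc i ⊔ j ≡ i ⊔ j
⊔-flatˡ i<j = trans (ℕ.m≤n⇒m⊔n≡n i<j) (sym (ℕ.m≤n⇒m⊔n≡n (ℕ.<⇒≤ i<j)))

⊔-flatʳ : ∀ {i j} → j < i → i ⊔ suc j ≡ i ⊔ j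
⊔-flatʳ j<i = trans (ℕ.m≥n⇒m⊔n≡m j<i) (sym (ℕ.m≥n⇒m⊔n≡m (ℕ.<⇒≤ j<i)))

module _ {N K f} (st : IsStaircase N K f) where
  open IsStaircase st

  value-start : value f 0 0 ≡ 0ℤ
  value-start with f 0 0 | start
  ... | false | _ = refl
  ... | true  | h = ⊥-elim (h tt)

  value-end : value f N K ≡ + (N ⊔ K) ℤ.- 1ℤ
  value-end with f N K | end
  ... | true | _ = refl

  -- Moving down raises `i ⊔ j` exactly when starting on or below the main diagonal, which is why
  -- the monotonicity changes direction there.
  value-vertical : ∀ i j → i < N → j ≤ K → EqualsOrOneMoreThan (value f (suc i) j) (value f i j)
  value-vertical i j i<N j≤K with j ℕ.≤? i
  ... | yes j≤i = sucMax⁺ (f (suc i) j) (f i j) (⊔-riseˡ j≤i) (down-lower i j i<N j≤K j≤i)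
  ... | no  j≰i = sameMax⁺ (f (suc i) j) (f i j) (⊔-flatˡ (ℕ.≰⇒> j≰i))
      (down-upper i j i<N j≤K (ℕ.≰⇒> j≰i))

  value-horizontal : ∀ i j → i ≤ N → j < K → EqualsOrOneMoreThan (value f i (suc j)) (value f i j)
  value-horizontal i j i≤N j<K with i ℕ.≤? j
  ... | yes i≤j = sucMax⁺ (f i (suc j)) (f i j) (⊔-riseʳ i≤j) (right-upper i j i≤N j<K i≤j)
  ... | no  i≰j = sameMax⁺ (f i (suc j)) (f i j) (⊔-flatʳ (ℕ.≰⇒> i≰j))
      (right-lower i j i≤N j<K (ℕ.≰⇒> i≰j))

  value-diagonal : ∀ i j → i < N → j < K →
    EqualsOrOneMoreThan (value f (suc i) (suc j)) (value f i j)
  value-diagonal i j i<N j<K = sucMax⁺ (f (suc i) (suc j)) (f i j) refl (diagonal i j i<N j<K)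

∣weight∣≤1 : ∀ M x → ∣ (+ M ℤ.- weight x) ℤ.- + M ∣ ≤ 1
∣weight∣≤1 M x = subst (λ z → ∣ z ∣ ≤ 1) (sym (cancel (+ M) (weight x))) (cases x)
  where
  cancel : ∀ y w → (y ℤ.- w) ℤ.- y ≡ ℤ.- w
  cancel = solveℤ-∀
  cases : ∀ x → ∣ ℤ.- weight x ∣ ≤ 1
  cases false = z≤n
  cases true  = s≤s z≤n

toℕ≤ : ∀ {N} (i : Fin (suc N)) → toℕ i ≤ N
toℕ≤ i = ℕ.s≤s⁻¹ (Fin.toℕ<n i)

toArray-valid : ∀ {N K f} → IsStaircase N K f → IsValid 1 (suc N) (suc K) (toArray f)
toArray-valid {N} {K} {f} st = record
  { first = λ i j i≡ j≡ → trans (entry-toArray f i j)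
      (trans (cong₂ (value f) (ℕ.suc-injective i≡) (ℕ.suc-injective j≡)) (value-start st))
  ; last = λ i j i≡ j≡ → trans (entry-toArray f i j)
      (trans (cong₂ (value f) (ℕ.suc-injective i≡) (ℕ.suc-injective j≡)) (value-end st))
  ; vertical = λ i i′ j i≡ → transport i j i′ j
      (value-vertical st (toℕ i′) (toℕ j) (below i i′ i≡) (toℕ≤ j))
      (ℕ.suc-injective i≡) refl
  ; horizontal = λ i j j′ j≡ → transport i j i j′
      (value-horizontal st (toℕ i) (toℕ j′) (toℕ≤ i) (below j j′ j≡))
      refl (ℕ.suc-injective j≡)
  ; diagonal = λ i i′ j j′ i≡ j≡ → transport i j i′ j′
      (value-diagonal st (toℕ i′) (toℕ j′) (below i i′ i≡) (below j j′ j≡))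
      (ℕ.suc-injective i≡) (ℕ.suc-injective j≡)
  ; bounded = λ i j → subst (λ z → ∣ z ℤ.- + (toℕ i ⊔ toℕ j) ∣ ≤ 1) (sym (entry-toArray f i j))
      (∣weight∣≤1 (toℕ i ⊔ toℕ j) (f (toℕ i) (toℕ j)))
  }
  where
  below : ∀ {L} (i i′ : Fin (suc L)) → pos i ≡ suc (pos i′) → toℕ i′ < L
  below i i′ i≡ = ℕ.≤-trans (ℕ.≤-reflexive (sym (ℕ.suc-injective i≡))) (toℕ≤ i)
  transport : ∀ i j i′ j′ {p q} → EqualsOrOneMoreThan (value f p q) (value f (toℕ i′) (toℕ j′)) →
    toℕ i ≡ p → toℕ j ≡ q →
    EqualsOrOneMoreThan (entry {suc N} {suc K} (toArray f) i j) (entry (toArray f) i′ j′)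
  transport i j i′ j′ h refl refl =
    subst₂ EqualsOrOneMoreThan (sym (entry-toArray f i j)) (sym (entry-toArray f i′ j′)) h

-- Valid arrays give staircases.

toℕ-mod : ∀ {N i} → i ≤ N → toℕ (i mod suc N) ≡ i
toℕ-mod i≤N = trans (Fin.toℕ-fromℕ< _) (m<n⇒m%n≡m (s≤s i≤N))

mod-toℕ : ∀ {N} (i : Fin (suc N)) → toℕ i mod suc N ≡ i
mod-toℕ i = Fin.toℕ-injective (toℕ-mod (toℕ≤ i))

weight-injective : ∀ {x y} → weight x ≡ weight y → x ≡ y
weight-injective {false} {false} _ = refl
weight-injective {true}  {true}  _ = refl

value-injective : ∀ M {x y} → + M ℤ.- weight x ≡ + M ℤ.- weight y → x ≡ y
value-injective M eq = weight-injective (ℤ.neg-injective (∙-cancelˡ (+ M) _ _ eq))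

EqualsOrOneMoreThan⇒≤ : ∀ {x y M} → EqualsOrOneMoreThan x y → y ℤ.≤ + M → x ℤ.≤ + suc M
EqualsOrOneMoreThan⇒≤ {M = M} (inj₁ refl) y≤M = ℤ.≤-trans y≤M (ℤ.+≤+ (ℕ.n≤1+n M))
EqualsOrOneMoreThan⇒≤ {M = M} (inj₂ refl) y≤M =
  ℤ.≤-trans (ℤ.+-monoˡ-≤ 1ℤ y≤M) (ℤ.≤-reflexive (ℤ.+-comm (+ M) 1ℤ))

-- Of the three integers within 1 of `M`, the hypothesis `x ≤ M` excludes `M + 1`.
deficit : ∀ M x → x ℤ.≤ + M → ∣ x ℤ.- + M ∣ ≤ 1 →
          x ≡ + M ℤ.- weight (isYes (x ℤ.≟ + M ℤ.- 1ℤ))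
deficit M x x≤M near with x ℤ.≟ + M ℤ.- 1ℤ
... | yes eq = eq
... | no neq = cases (x ℤ.- + M) (regroup x (+ M)) (ℤ.i≤j⇒i-j≤0 x≤M) near
  where
  regroup : ∀ y z → y ≡ z ℤ.+ (y ℤ.- z)
  regroup = solveℤ-∀
  cases : ∀ d → x ≡ + M ℤ.+ d → d ℤ.≤ 0ℤ → ∣ d ∣ ≤ 1 → x ≡ + M ℤ.- 0ℤ
  cases (+ zero)       eq _              _        = eq
  cases (+ suc _)      eq (ℤ.+≤+ ())     _
  cases -[1+ zero ]    eq _              _        = contradiction eq neq
  cases -[1+ suc _ ]   eq _              (s≤s ())

module _ {N K} {a : Array (suc N) (suc K)} (valid : IsValid 1 (suc N) (suc K) a) where
  open IsValid valid

  -- Reducing modulo the sizes makes the array total on natural indices; by `toℕ-mod` indices up to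
  -- `N` and `K` are unaffected.
  at : ℕ → ℕ → ℤ
  at i j = entry a (i mod suc N) (j mod suc K)

  pos-suc : ∀ {L i} → i < L → pos (suc i mod suc L) ≡ suc (pos (i mod suc L))
  pos-suc i<L = cong suc (trans (toℕ-mod i<L) (cong suc (sym (toℕ-mod (ℕ.<⇒≤ i<L)))))

  at-vertical : ∀ i j → i < N → EqualsOrOneMoreThan (at (suc i) j) (at i j)
  at-vertical i j i<N = vertical _ _ _ (pos-suc i<N)

  at-horizontal : ∀ i j → j < K → EqualsOrOneMoreThan (at i (suc j)) (at i j)
  at-horizontal i j j<K = horizontal _ _ _ (pos-suc j<K)

  at-diagonal : ∀ i j → i < N → j < K → EqualsOrOneMoreThan (at (suc i) (suc j)) (at i j)
  at-diagonal i j i<N j<K = diagonal _ _ _ _ (pos-suc i<N) (pos-suc j<K)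

  at-start : at 0 0 ≡ 0ℤ
  at-start = first _ _ refl refl

  at-end : at N K ≡ + (N ⊔ K) ℤ.- 1ℤ
  at-end = last _ _ (cong suc (toℕ-mod {N} ℕ.≤-refl)) (cong suc (toℕ-mod {K} ℕ.≤-refl))

  -- Position (i,j) is reached from the zero corner in `i ⊔ j` moves, along the border and then
  -- diagonally, each adding at most 1. This excludes the value one above the maximum, which
  -- `bounded` alone would allow.
  at-≤ : ∀ i j → i ≤ N → j ≤ K → at i j ℤ.≤ + (i ⊔ j)
  at-≤ zero    zero    _  _  = ℤ.≤-reflexive at-start
  at-≤ (suc i) zero    i< j≤ = EqualsOrOneMoreThan⇒≤ (at-vertical i 0 i<)
    (subst (λ M → at i 0 ℤ.≤ + M) (ℕ.⊔-identityʳ i) (at-≤ i 0 (ℕ.<⇒≤ i<) z≤n))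
  at-≤ zero    (suc j) i≤ j< = EqualsOrOneMoreThan⇒≤ (at-horizontal 0 j j<)
    (at-≤ 0 j z≤n (ℕ.<⇒≤ j<))
  at-≤ (suc i) (suc j) i< j< = EqualsOrOneMoreThan⇒≤ (at-diagonal i j i< j<)
    (at-≤ i j (ℕ.<⇒≤ i<) (ℕ.<⇒≤ j<))

  deficits : ℕ → ℕ → Bool
  deficits i j = isYes (at i j ℤ.≟ + (i ⊔ j) ℤ.- 1ℤ)

  at≡value : ∀ i j → i ≤ N → j ≤ K → at i j ≡ value deficits i j
  at≡value i j i≤ j≤ = deficit (i ⊔ j) (at i j) (at-≤ i j i≤ j≤)
    (subst₂ (λ p q → ∣ at i j ℤ.- + (p ⊔ q) ∣ ≤ 1) (toℕ-mod i≤) (toℕ-mod j≤)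
      (bounded (i mod suc N) (j mod suc K)))

  deficits-isStaircase : IsStaircase N K deficits
  deficits-isStaircase = record
    -- The corner 0 is read as `+ 0` minus `weight false`, the prescribed last entry as the maximum
    -- minus `weight true`.
    { start = λ h → ≡⇒⟹ (value-injective 0 {y = false}
        (trans (sym (at≡value 0 0 z≤n z≤n)) at-start)) h
    ; end = ≡⇒⟹ (value-injective (N ⊔ K) {x = true}
        (trans (sym at-end) (at≡value N K ℕ.≤-refl ℕ.≤-refl))) tt
    ; down-lower = λ i j i< j≤ j≤i → sucMax⁻ (deficits (suc i) j) (deficits i j) (⊔-riseˡ j≤i)
        (values i< j≤ (ℕ.<⇒≤ i<) j≤ (at-vertical i j i<))
    ; down-upper = λ i j i< j≤ i<j → sameMax⁻ (deficits (suc i) j) (deficits i j) (⊔-flatˡ i<j)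
        (values i< j≤ (ℕ.<⇒≤ i<) j≤ (at-vertical i j i<))
    ; right-upper = λ i j i≤ j< i≤j → sucMax⁻ (deficits i (suc j)) (deficits i j) (⊔-riseʳ i≤j)
        (values i≤ j< i≤ (ℕ.<⇒≤ j<) (at-horizontal i j j<))
    ; right-lower = λ i j i≤ j< j<i → sameMax⁻ (deficits i (suc j)) (deficits i j) (⊔-flatʳ j<i)
        (values i≤ j< i≤ (ℕ.<⇒≤ j<) (at-horizontal i j j<))
    ; diagonal = λ i j i< j< → sucMax⁻ (deficits (suc i) (suc j)) (deficits i j) refl
        (values i< j< (ℕ.<⇒≤ i<) (ℕ.<⇒≤ j<) (at-diagonal i j i< j<))
    }
    where
    values : ∀ {i j i′ j′} → i ≤ N → j ≤ K → i′ ≤ N → j′ ≤ K →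
      EqualsOrOneMoreThan (at i j) (at i′ j′) →
      EqualsOrOneMoreThan (value deficits i j) (value deficits i′ j′)
    values i≤ j≤ i′≤ j′≤ =
      subst₂ EqualsOrOneMoreThan (at≡value _ _ i≤ j≤) (at≡value _ _ i′≤ j′≤)

  entry≡value : ∀ i j → entry a i j ≡ value deficits (toℕ i) (toℕ j)
  entry≡value i j = trans (sym (cong₂ (entry a) (mod-toℕ i) (mod-toℕ j)))
    (at≡value (toℕ i) (toℕ j) (toℕ≤ i) (toℕ≤ j))

-- Codes correspond to valid arrays.

-- Leaving n free, with 1 + k + m ≡ n as a hypothesis, keeps `H 1 n (suc k)` stuck on n during
-- conversion checking; otherwise Agda starts to enumerate and filter the arrays.
decode : ∀ n → Code m k → Array n (suc k)
decode n c = toArray (bit c)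

decode-valid : ∀ {n} (c : Code m k) → suc k ℕ.+ m ≡ n → IsValid 1 n (suc k) (decode n c)
decode-valid c refl = toArray-valid (bit-isStaircase c)

decode-injective : ∀ {n} {c d : Code m k} → suc k ℕ.+ m ≡ n → decode n c ≡ decode n d → c ≡ d
decode-injective {c = c} {d} refl eq = bit-injective c d λ i j i≤ j≤ →
  subst₂ (λ p q → bit c p q ≡ bit d p q) (toℕ-mod i≤) (toℕ-mod j≤) (bits (i mod _) (j mod _))
  where
  bits : ∀ i j → bit c (toℕ i) (toℕ j) ≡ bit d (toℕ i) (toℕ j)
  bits i j = value-injective (toℕ i ⊔ toℕ j) (trans (sym (entry-toArray (bit c) i j))
    (trans (cong (λ a → entry a i j) eq) (entry-toArray (bit d) i j)))

decode-surjective : ∀ {n a} → suc k ℕ.+ m ≡ n → IsValid 1 n (suc k) a →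
                    ∃[ c ] a ≡ decode {m} {k} n c
decode-surjective {k} {m} {a = a} refl valid =
  let c , eq = bit-surjective {m} k (deficits-isStaircase valid) in
  c , toArray-unique a (bit c) λ i j → trans (entry≡value valid i j)
    (cong (λ x → + (toℕ i ⊔ toℕ j) ℤ.- weight x) (eq (toℕ i) (toℕ j) (toℕ≤ i) (toℕ≤ j)))

-- Counting codes.

bools : List Bool
bools = true ∷ false ∷ []

∈-bools : ∀ p → p ∈ bools
∈-bools true  = here refl
∈-bools false = there (here refl)

bools-unique : Unique bools
bools-unique = ((λ ()) ∷ []) ∷ [] ∷ []

steps : List (Code m k) → List (Code m (suc k))
steps = cartesianProductWith (uncurry step) (cartesianProduct bools bools)

codes : ∀ m k → List (Code m k)
codes m zero    = map base (allFin m)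
codes m (suc k) = ones ∷ steps (codes m k)

∈-codes : ∀ (c : Code m k) → c ∈ codes m k
∈-codes (base i)     = Mem.∈-map⁺ base (Mem.∈-allFin i)
∈-codes ones         = here refl
∈-codes (step p q c) = there (Mem.∈-cartesianProductWith⁺ (uncurry step)
  (Mem.∈-cartesianProduct⁺ (∈-bools p) (∈-bools q)) (∈-codes c))

codes-unique : ∀ m k → Unique (codes m k)
codes-unique m zero    = Unique.map⁺ (λ { refl → refl }) (Unique.allFin⁺ m)
codes-unique m (suc k) = All.tabulate ones∉ ∷
  Unique.cartesianProductWith⁺ (uncurry step) (λ { refl → refl , refl })
    (Unique.cartesianProduct⁺ bools-unique bools-unique) (codes-unique m k)
  where
  ones∉ : ∀ {c} → c ∈ steps (codes m k) → ones ≢ c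
  ones∉ c∈ refl
    with Mem.∈-cartesianProductWith⁻ (uncurry step) (cartesianProduct bools bools) (codes m k) c∈
  ... | _ , _ , _ , _ , ()

length-cartesianProductWith : ∀ {A B C : Set} (f : A → B → C) xs ys →
  length (cartesianProductWith f xs ys) ≡ length xs ℕ.* length ys
length-cartesianProductWith f []       ys = refl
length-cartesianProductWith f (x ∷ xs) ys = trans (List.length-++ (map (f x) ys))
  (cong₂ ℕ._+_ (List.length-map (f x) ys) (length-cartesianProductWith f xs ys))

-- The recursion L(k+1) = 4 L(k) + 1 with L(0) = m becomes geometric for 3 L + 1, which keeps the
-- computation in the natural numbers.
length-codes : ∀ m k → 3 ℕ.* length (codes m k) ℕ.+ 1 ≡ 4 ^ k ℕ.* (3 ℕ.* m ℕ.+ 1)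
length-codes m zero = trans
  (cong (λ l → 3 ℕ.* l ℕ.+ 1)
    (trans (List.length-map base (allFin m)) (List.length-tabulate {n = m} id)))
  (sym (ℕ.*-identityˡ (3 ℕ.* m ℕ.+ 1)))
length-codes m (suc k) = begin
  3 ℕ.* suc (length (steps (codes m k))) ℕ.+ 1
    ≡⟨ cong (λ l → 3 ℕ.* suc l ℕ.+ 1)
         (length-cartesianProductWith (uncurry step) (cartesianProduct bools bools) (codes m k)) ⟩
  3 ℕ.* suc (4 ℕ.* length (codes m k)) ℕ.+ 1
    ≡⟨ regroup (length (codes m k)) ⟩
  4 ℕ.* (3 ℕ.* length (codes m k) ℕ.+ 1)
    ≡⟨ cong (4 ℕ.*_) (length-codes m k) ⟩
  4 ℕ.* (4 ^ k ℕ.* (3 ℕ.* m ℕ.+ 1))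
    ≡⟨ ℕ.*-assoc 4 (4 ^ k) (3 ℕ.* m ℕ.+ 1) ⟨
  4 ^ suc k ℕ.* (3 ℕ.* m ℕ.+ 1) ∎
  where
  open ≡-Reasoning
  regroup : ∀ l → 3 ℕ.* suc (4 ℕ.* l) ℕ.+ 1 ≡ 4 ℕ.* (3 ℕ.* l ℕ.+ 1)
  regroup = solveℕ-∀

-- Counting valid arrays.

-- Without repetitions, equal membership means equal multiplicities, hence a permutation.
unique∧set⇒≡length : ∀ {A : Set} {xs ys : List A} → Unique xs → Unique ys →
  (∀ {x} → x ∈ xs → x ∈ ys) → (∀ {x} → x ∈ ys → x ∈ xs) → length xs ≡ length ys
unique∧set⇒≡length u v f g = ↭-length (∼bag⇒↭ (unique∧set⇒bag u v (mk⇔ f g)))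

H≡length : ∀ r n k (xs : List (Array n k)) → Unique xs →
  (∀ {a} → a ∈ xs → IsValid r n k a) → (∀ {a} → IsValid r n k a → a ∈ xs) →
  H r n k ≡ length xs
H≡length r n k xs unique sound complete =
  unique∧set⇒≡length {xs = validArrays r n k} {ys = xs} (validArrays-unique r n k) unique
    (λ {a} a∈ → complete (Equivalence.to (∈-validArrays r n k a) a∈))
    (λ {a} a∈ → Equivalence.from (∈-validArrays r n k a) (sound a∈))

H≡length-codes : ∀ m k {n} → suc k ℕ.+ m ≡ n → H 1 n (suc k) ≡ length (codes m k)
H≡length-codes m k {n} n≡ = trans
  (H≡length 1 n (suc k) (map (decode n) (codes m k))
    (Unique.map⁺ (decode-injective n≡) (codes-unique m k)) sound complete)
  (List.length-map (decode n) (codes m k))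
  where
  sound : ∀ {a} → a ∈ map (decode n) (codes m k) → IsValid 1 n (suc k) a
  sound a∈ = let c , _ , a≡ = Mem.∈-map⁻ (decode n) a∈ in
    subst (IsValid 1 n (suc k)) (sym a≡) (decode-valid c n≡)
  complete : ∀ {a} → IsValid 1 n (suc k) a → a ∈ map (decode n) (codes m k)
  complete valid = let c , a≡ = decode-surjective {k} {m} n≡ valid in
    subst (_∈ map (decode n) (codes m k)) (sym a≡) (Mem.∈-map⁺ (decode n) (∈-codes c))

-- The closed form over the rationals.

-- `fromℕ` normalises its fraction; passing to unnormalised fractions with denominator 1 reduces
-- sums and products to integer identities.
toℚᵘ-fromℕ : ∀ a → toℚᵘ (fromℕ a) ℚᵘ.≃ mkℚᵘ (+ a) 0
toℚᵘ-fromℕ a = ℚ.toℚᵘ-fromℚᵘ (mkℚᵘ (+ a) 0)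

fromℕ-+ : ∀ a b → fromℕ (a ℕ.+ b) ≡ fromℕ a + fromℕ b
fromℕ-+ a b = ℚ.toℚᵘ-injective (begin
  toℚᵘ (fromℕ (a ℕ.+ b))              ≈⟨ toℚᵘ-fromℕ (a ℕ.+ b) ⟩
  mkℚᵘ (+ (a ℕ.+ b)) 0                ≈⟨ *≡* (identity (+ a) (+ b)) ⟩
  mkℚᵘ (+ a) 0 ℚᵘ.+ mkℚᵘ (+ b) 0      ≈⟨ ℚᵘ.+-cong (toℚᵘ-fromℕ a) (toℚᵘ-fromℕ b) ⟨
  toℚᵘ (fromℕ a) ℚᵘ.+ toℚᵘ (fromℕ b)  ≈⟨ ℚ.toℚᵘ-homo-+ (fromℕ a) (fromℕ b) ⟨
  toℚᵘ (fromℕ a + fromℕ b)            ∎)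
  where
  open import Relation.Binary.Reasoning.Setoid ℚᵘ.≃-setoid
  identity : ∀ x y → (x ℤ.+ y) ℤ.* + 1 ≡ (x ℤ.* + 1 ℤ.+ y ℤ.* + 1) ℤ.* + 1
  identity = solveℤ-∀

fromℕ-* : ∀ a b → fromℕ (a ℕ.* b) ≡ fromℕ a * fromℕ b
fromℕ-* a b = ℚ.toℚᵘ-injective (begin
  toℚᵘ (fromℕ (a ℕ.* b))              ≈⟨ toℚᵘ-fromℕ (a ℕ.* b) ⟩
  mkℚᵘ (+ (a ℕ.* b)) 0                ≈⟨ *≡* (cong (ℤ._* + 1) (ℤ.pos-* a b)) ⟩
  mkℚᵘ (+ a) 0 ℚᵘ.* mkℚᵘ (+ b) 0      ≈⟨ ℚᵘ.*-cong (toℚᵘ-fromℕ a) (toℚᵘ-fromℕ b) ⟨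
  toℚᵘ (fromℕ a) ℚᵘ.* toℚᵘ (fromℕ b)  ≈⟨ ℚ.toℚᵘ-homo-* (fromℕ a) (fromℕ b) ⟨
  toℚᵘ (fromℕ a * fromℕ b)            ∎)
  where open import Relation.Binary.Reasoning.Setoid ℚᵘ.≃-setoid

fromℕ-3*+1 : ∀ a → fromℕ (3 ℕ.* a ℕ.+ 1) ≡ fromℕ 3 * fromℕ a + 1ℚ
fromℕ-3*+1 a = trans (fromℕ-+ (3 ℕ.* a) 1) (cong (_+ 1ℚ) (fromℕ-* 3 a))

-- Solves the hypothesis for `h`; `p` stands for the power of 4, and `m` appears as (k + m) - k to
-- match n - k.
closed-form : ∀ h p m k → 3 ℕ.* h ℕ.+ 1 ≡ p ℕ.* (3 ℕ.* m ℕ.+ 1) →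
  fromℕ h ≡ fromℕ p * (fromℕ (k ℕ.+ m) - fromℕ k) + (+ 1 / 3) * (fromℕ p - 1ℚ)
closed-form h p m k eq = begin
  fromℕ h                                              ≡⟨ solve-h (fromℕ h) ⟩
  (+ 1 / 3) * ((fromℕ 3 * fromℕ h + 1ℚ) - 1ℚ)          ≡⟨ cong (λ x → (+ 1 / 3) * (x - 1ℚ)) eqℚ ⟩
  (+ 1 / 3) * (fromℕ p * (fromℕ 3 * fromℕ m + 1ℚ) - 1ℚ) ≡⟨ expand (fromℕ p) (fromℕ m) (fromℕ k) ⟩
  fromℕ p * (fromℕ k + fromℕ m - fromℕ k) + (+ 1 / 3) * (fromℕ p - 1ℚ)
    ≡⟨ cong (λ x → fromℕ p * (x - fromℕ k) + (+ 1 / 3) * (fromℕ p - 1ℚ)) (fromℕ-+ k m) ⟨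
  fromℕ p * (fromℕ (k ℕ.+ m) - fromℕ k) + (+ 1 / 3) * (fromℕ p - 1ℚ) ∎
  where
  open ≡-Reasoning
  open +-*-Solver
  eqℚ : fromℕ 3 * fromℕ h + 1ℚ ≡ fromℕ p * (fromℕ 3 * fromℕ m + 1ℚ)
  eqℚ = begin
    fromℕ 3 * fromℕ h + 1ℚ              ≡⟨ fromℕ-3*+1 h ⟨
    fromℕ (3 ℕ.* h ℕ.+ 1)               ≡⟨ cong fromℕ eq ⟩
    fromℕ (p ℕ.* (3 ℕ.* m ℕ.+ 1))       ≡⟨ fromℕ-* p (3 ℕ.* m ℕ.+ 1) ⟩
    fromℕ p * fromℕ (3 ℕ.* m ℕ.+ 1)     ≡⟨ cong (fromℕ p *_) (fromℕ-3*+1 m) ⟩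
    fromℕ p * (fromℕ 3 * fromℕ m + 1ℚ)  ∎
  solve-h : ∀ x → x ≡ (+ 1 / 3) * ((fromℕ 3 * x + 1ℚ) - 1ℚ)
  solve-h = solve 1 (λ x → x := con (+ 1 / 3) :* ((con (fromℕ 3) :* x :+ con 1ℚ) :- con 1ℚ)) refl
  expand : ∀ p m k → (+ 1 / 3) * (p * (fromℕ 3 * m + 1ℚ) - 1ℚ) ≡
                     p * (k + m - k) + (+ 1 / 3) * (p - 1ℚ)
  expand = solve 3 (λ p m k → con (+ 1 / 3) :* (p :* (con (fromℕ 3) :* m :+ con 1ℚ) :- con 1ℚ) :=
                     p :* (k :+ m :- k) :+ con (+ 1 / 3) :* (p :- con 1ℚ)) refl

theorem2 : ∀ (n k : ℕ) → n ≥ k → k ≥ 1 →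
    fromℕ (H 1 n k) ≡
    fromℕ (4 ^ (k ∸ 1)) * (fromℕ n - fromℕ k) + (+ 1 / 3) * (fromℕ (4 ^ (k ∸ 1)) - 1ℚ)
theorem2 n (suc k) n≥k _ = let d = n ∸ suc k ; n≡ = ℕ.m+[n∸m]≡n n≥k in begin
  fromℕ (H 1 n (suc k))        ≡⟨ cong fromℕ (H≡length-codes d k n≡) ⟩
  fromℕ (length (codes d k))
    -- The surplus `d` of rows over columns is the parameter `m` of the codes.
    ≡⟨ closed-form (length (codes d k)) (4 ^ k) d (suc k) (length-codes d k) ⟩
  formula (suc k ℕ.+ d)        ≡⟨ cong formula n≡ ⟩
  formula n                    ∎
  where
  open ≡-Reasoning
  formula : ℕ → ℚ
  formula n = fromℕ (4 ^ k) * (fromℕ n - fromℕ (suc k)) + (+ 1 / 3) * (fromℕ (4 ^ k) - 1ℚ)
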